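{- The numbers $\operatorname{op}_{n,n-1}(123)$ satisfy $\operatorname{op}_{2,1}(123)=1$ and, for all $n>2$, $$\operatorname{op}_{n,n-1}(123) = \frac{(4n-6)(n-1)^2}{(n-2)^2(n+1)}\operatorname{op}_{n-1,n-2}(123).$$
   Context: An ordered set partition of $[n]$ into $k$ blocks is a sequence $B_1/B_2/\cdots/B_k$ of nonempty, pairwise disjoint subsets of $[n]$ whose union is $[n]$; the order of the blocks matters, but not the order of elements within a block. For a permutation $\rho=\rho_1\cdots\rho_m\in\mathcal{S}_m$, an ordered partition $B_1/\cdots/B_k$ contains $\rho$ if there are block indices $i_1<i_2<\cdots<i_m$ and elements $b_j\in B_{i_j}$ such that $b_1\cdots b_m$ is order-isomorphic to $\rho$ (i.e. $b_a<b_c$ iff $\rho_a<\rho_c$); otherwise it avoids $\rho$. $\operatorname{op}_{n,k}(\rho)$ denotes the number of ordered partitions of $[n]$ into $k$ blocks that avoid $\rho$. -}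

module Defs where

open import Data.Bool.Base using (Bool; true; false)
open import Data.Fin.Base as Fin using (Fin)
import Data.Fin.Properties as Fin
open import Data.Fin.Permutation as Perm using (Permutation′; _⟨$⟩ʳ_)
open import Data.Fin.Subset using (Subset; _∈_; _∩_; Nonempty; Empty)
open import Data.Fin.Subset.Properties using (_∈?_; nonempty?)
open import Data.List.Base using (List; []; _∷_; allFin; cartesianProductWith; filter; length)
import Data.List.Membership.Propositional as List
import Data.List.Membership.Propositional.Properties as List
open import Data.List.Relation.Unary.All as All using ()
open import Data.List.Relation.Unary.AllPairs as AllPairs using ()
open import Data.List.Relation.Unary.Any using (here; there; any?)
open import Data.List.Relation.Unary.Unique.Propositional using (Unique)
import Data.List.Relation.Unary.Unique.Propositional.Properties as Unique
open import Data.Nat.Base using (ℕ; zero; suc; _+_; _*_; _∸_; _^_; _<_; NonZero; s≤s)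
open import Data.Product.Base using (∃; ∃-syntax; _×_; _,_)
open import Data.Vec.Base as Vec using (Vec; lookup)
open import Data.Vec.Properties using (∷-injective)
open import Function.Bundles using (_⇔_; mk⇔; Equivalence)
open import Level using (Level)
open import Relation.Binary.PropositionalEquality using (_≡_; _≢_; refl)
open import Relation.Nullary.Decidable using (Dec; map′; _×-dec_; _→-dec_; ¬?)
open import Relation.Nullary.Negation using (¬_)
open import Relation.Unary using (Pred; Decidable)

private
  variable
    a p : Level
    A : Set a
    k m n : ℕ

-- The ground set [n] is rendered as Fin n (elements 0, …, n-1 instead of
-- 1, …, n); only the order of the elements is used.

record IsOrderedPartition (B : Vec (Subset n) k) : Set where
  field
    nonempty : ∀ i → Nonempty (lookup B i)
    disjoint : ∀ i j → i ≢ j → Empty (lookup B i ∩ lookup B j)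
    covering : ∀ x → ∃[ i ] x ∈ lookup B i

StrictlyIncreasing : Vec (Fin k) m → Set
StrictlyIncreasing is = ∀ a c → a Fin.< c → lookup is a Fin.< lookup is c

OrderIsomorphic : Vec (Fin n) m → Permutation′ m → Set
OrderIsomorphic bs ρ =
  ∀ a c → lookup bs a Fin.< lookup bs c ⇔ (ρ ⟨$⟩ʳ a) Fin.< (ρ ⟨$⟩ʳ c)

Contains : Vec (Subset n) k → Permutation′ m → Set
Contains {n} {k} {m} B ρ =
  ∃[ is ] ∃[ bs ] StrictlyIncreasing {k} {m} is
                × (∀ j → lookup bs j ∈ lookup B (lookup is j))
                × OrderIsomorphic {n} {m} bs ρ

Avoids : Vec (Subset n) k → Permutation′ m → Set
Avoids B ρ = ¬ Contains B ρ

vecs : List A → (k : ℕ) → List (Vec A k)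
vecs xs zero    = Vec.[] ∷ []
vecs xs (suc k) = cartesianProductWith Vec._∷_ xs (vecs xs k)

vecs-complete : {xs : List A} → (∀ x → x List.∈ xs) →
                (v : Vec A k) → v List.∈ vecs xs k
vecs-complete all Vec.[]       = here refl
vecs-complete all (x Vec.∷ v) =
  List.∈-cartesianProductWith⁺ Vec._∷_ (all x) (vecs-complete all v)

vecs-unique : {xs : List A} → Unique xs → ∀ k → Unique (vecs xs k)
vecs-unique xs! zero    = All.[] AllPairs.∷ AllPairs.[]
vecs-unique xs! (suc k) =
  Unique.cartesianProductWith⁺ Vec._∷_ ∷-injective xs! (vecs-unique xs! k)

bools : List Bool
bools = false ∷ true ∷ []

-- Subset n is by definition Vec Bool n.
subsets : (n : ℕ) → List (Subset n)
subsets = vecs bools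

blockSequences : (n k : ℕ) → List (Vec (Subset n) k)
blockSequences n = vecs (subsets n)

-- Each sequence of k subsets of [n] is listed exactly once, so that op below
-- is a cardinality.
blockSequences-complete : (B : Vec (Subset n) k) → B List.∈ blockSequences n k
blockSequences-complete = vecs-complete (vecs-complete bools-complete)
  where
  bools-complete : ∀ b → b List.∈ bools
  bools-complete false = here refl
  bools-complete true  = there (here refl)

blockSequences-unique : ∀ n k → Unique (blockSequences n k)
blockSequences-unique n = vecs-unique (vecs-unique bools-unique n)
  where
  bools-unique : Unique bools
  bools-unique = ((λ ()) All.∷ All.[]) AllPairs.∷ All.[] AllPairs.∷ AllPairs.[]

isOrderedPartition? : Decidable (IsOrderedPartition {n} {k})
isOrderedPartition? B = map′
  (λ (ne , dj , cov) → record { nonempty = ne ; disjoint = dj ; covering = cov })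
  (λ P → let open IsOrderedPartition P in nonempty , disjoint , covering)
  (Fin.all? (λ i → nonempty? (lookup B i))
   ×-dec Fin.all? (λ i → Fin.all? λ j →
           ¬? (i Fin.≟ j) →-dec ¬? (nonempty? (lookup B i ∩ lookup B j)))
   ×-dec Fin.all? (λ x → Fin.any? λ i → x ∈? lookup B i))

∃Vec? : {P : Pred (Vec (Fin n) m) p} → Decidable P → Dec (∃ P)
∃Vec? {n = n} {m = m} P? = map′
  (λ any → let v , _ , Pv = List.find any in v , Pv)
  (λ (v , Pv) → List.lose (vecs-complete List.∈-allFin v) Pv)
  (any? P? (vecs (allFin n) m))

contains? : (B : Vec (Subset n) k) (ρ : Permutation′ m) → Dec (Contains B ρ)
contains? B ρ = ∃Vec? λ is → ∃Vec? λ bs →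
  Fin.all? (λ a → Fin.all? λ c →
    (a Fin.<? c) →-dec (lookup is a Fin.<? lookup is c))
  ×-dec Fin.all? (λ j → lookup bs j ∈? lookup B (lookup is j))
  ×-dec Fin.all? (λ a → Fin.all? λ c →
    (lookup bs a Fin.<? lookup bs c) ⇔? ((ρ ⟨$⟩ʳ a) Fin.<? (ρ ⟨$⟩ʳ c)))
  where
  _⇔?_ : {P Q : Set} → Dec P → Dec Q → Dec (P ⇔ Q)
  P? ⇔? Q? = map′ (λ (f , g) → mk⇔ f g)
                  (λ e → Equivalence.to e , Equivalence.from e)
                  ((P? →-dec Q?) ×-dec (Q? →-dec P?))

avoids? : (ρ : Permutation′ m) → Decidable (λ (B : Vec (Subset n) k) → Avoids B ρ)
avoids? ρ B = ¬? (contains? B ρ)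

op : (n k : ℕ) → Permutation′ m → ℕ
op n k ρ =
  length (filter (λ B → isOrderedPartition? B ×-dec avoids? ρ B)
                 (blockSequences n k))

ρ₁₂₃ : Permutation′ 3
ρ₁₂₃ = Perm.id

denominator-nonZero : ∀ {n} → 2 < n → NonZero ((n ∸ 2) ^ 2 * (n + 1))
denominator-nonZero (s≤s (s≤s (s≤s _))) = _

{-# OPTIONS --safe #-}
-- Send each element of an ordered partition to the index of its block, counted from the last
-- block. This identifies the ordered partitions of [n] into k blocks avoiding 123 with the
-- surjective words of length n over k letters avoiding 321.
--
-- Such words form a generating tree: let s be the least top of a 21-pattern of w (s = k if w is
-- weakly increasing). A letter i can be put in front of w, either as a new letter (the letters ≥ i
-- being shifted up) or as a repetition of an old one, exactly when i ≤ s. For i > 0 the new value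
-- of s is i; for i = 0 it is s + 1 or s respectively. So the number of descendants of a word
-- depends only on s and k. For n = k + 1 exactly one letter is repeated, and the resulting
-- recurrences are solved by binomial coefficients:
-- (n + 1) op(n, n - 1) = 3 (n - 1) C(2n - 2, n - 2).
module Submission where

open import Defs
open import Data.Bool.Base using (true; false; if_then_else_)
open import Data.Empty using (⊥)
open import Data.Fin.Base as Fin using (Fin; zero; suc; toℕ; opposite; punchIn; punchOut)
open import Data.Fin.Patterns using (0F; 1F; 2F)
import Data.Fin.Properties as Fin
open import Data.Fin.Subset as Subset using (Subset)
open import Data.Fin.Subset.Properties using (x∈p∩q⁺; x∈p∩q⁻; ⊆-antisym)
import Data.Integer.Base as ℤ
import Data.Integer.Properties as ℤ
open import Data.List.Base as List using (List; []; _∷_; _++_; concatMap; filter; length)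
open import Data.List.Membership.Propositional using (_∈_; find; lose)
open import Data.List.Membership.Propositional.Properties using (∈-map⁺; ∈-map⁻; ∈-++⁺ˡ; ∈-++⁺ʳ; ∈-++⁻; ∈-concatMap⁺; ∈-concatMap⁻; ∈-filter⁺; ∈-filter⁻)
open import Data.List.Membership.Propositional.Properties.WithK using (unique∧set⇒bag)
open import Data.List.Properties using (length-map; map-++; map-∘; map-cong-local)
open import Data.List.Relation.Binary.BagAndSetEquality using (∼bag⇒↭)
open import Data.List.Relation.Binary.Permutation.Propositional.Properties using (↭-length)
open import Data.List.Relation.Unary.All as All using ([]; _∷_)
import Data.List.Relation.Unary.All.Properties as All
open import Data.List.Relation.Unary.AllPairs as AllPairs using ([]; _∷_)
import Data.List.Relation.Unary.AllPairs.Properties as AllPairs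
open import Data.List.Relation.Unary.Any using (here; there)
open import Data.List.Relation.Unary.Unique.Propositional using (Unique)
import Data.List.Relation.Unary.Unique.Propositional.Properties as Unique
open import Data.Nat.Base using (ℕ; zero; suc; _+_; _*_; _∸_; _^_; _≤_; _<_; _>_; _⊓_; z≤n; s≤s; s≤s⁻¹; NonZero)
open import Data.Nat.ListAction using (sum)
open import Data.Nat.ListAction.Properties using (sum-++)
open import Data.Nat.Properties
open import Data.Nat.Tactic.RingSolver using (solve-∀)
open import Data.Product.Base using (∃-syntax; _×_; _,_; proj₁; proj₂)
open import Data.Rational.Base as ℚ using (_/_)
import Data.Rational.Properties as ℚ
open import Data.Rational.Unnormalised.Base using (mkℚᵘ; *≡*)
import Data.Rational.Unnormalised.Properties as ℚᵘ
open import Data.Sum.Base using (inj₁; inj₂)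
open import Data.Vec.Base as Vec using (Vec; []; _∷_; lookup; tabulate)
open import Data.Vec.Membership.Propositional using () renaming (_∈_ to _∈ᵥ_)
open import Data.Vec.Membership.Propositional.Properties using (toAny) renaming (∈-map⁺ to ∈ᵥ-map⁺; ∈-lookup to ∈ᵥ-lookup)
open import Data.Vec.Properties using (∷-injective; lookup-map; lookup∘tabulate; tabulate∘lookup; tabulate-cong; []=⇒lookup; lookup⇒[]=)
open import Data.Vec.Relation.Unary.Any as VecAny using (here; there; any?)
import Data.Vec.Relation.Unary.Any.Properties as VecAny
open import Function.Base using (_∘_)
open import Function.Bundles using (mk⇔; Equivalence)
open import Relation.Binary.Definitions using (tri<; tri≈; tri>)
open import Relation.Binary.PropositionalEquality
open import Relation.Nullary.Decidable using (does; yes; no; dec-true; _×-dec_)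
open import Relation.Nullary.Negation using (¬_; contradiction)
open ≡-Reasoning

private
  variable
    A B : Set
    k m n : ℕ

-- Surjective words avoiding 321

Word : ℕ → ℕ → Set
Word k n = Vec (Fin k) n

Surjective : Word k n → Set
Surjective w = ∀ j → j ∈ᵥ w

Avoids321 : Word k n → Set
Avoids321 w = ∀ a b c → a Fin.< b → b Fin.< c →
              lookup w b Fin.< lookup w a → lookup w c Fin.< lookup w b → ⊥

DescentTops≥ : ℕ → Word k n → Set
DescentTops≥ m w = ∀ a c → a Fin.< c → lookup w c Fin.< lookup w a → m ≤ toℕ (lookup w a)

-- The least top of a 21-pattern, or the alphabet size if there is none.
leastTop : Word k n → ℕ
leastTop {k} []  = k
leastTop (i ∷ w) = if does (any? (Fin._<? i) w) then toℕ i ⊓ leastTop w else leastTop w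

leastTop≤k : (w : Word k n) → leastTop w ≤ k
leastTop≤k []      = ≤-refl
leastTop≤k (i ∷ w) with does (any? (Fin._<? i) w)
... | true  = ≤-trans (m⊓n≤n (toℕ i) _) (leastTop≤k w)
... | false = leastTop≤k w

DescentTops≥-tail : ∀ {i} {w : Word k n} → DescentTops≥ m (i ∷ w) → DescentTops≥ m w
DescentTops≥-tail d a c a<c = d (suc a) (suc c) (s≤s a<c)

DescentTops≥-∷ : ∀ i (w : Word k n) → m ≤ toℕ i → DescentTops≥ m w → DescentTops≥ m (i ∷ w)
DescentTops≥-∷ i w m≤i d zero    c       a<c       _  = m≤i
DescentTops≥-∷ i w m≤i d (suc a) (suc c) (s≤s a<c) lt = d a c a<c lt

-- With `m≤leastTop⁻` and `leastTop≤k` this characterises `leastTop w`; its values below are derived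
-- from these bounds. `m ≤ k` accounts for the default value `k`.
m≤leastTop⁺ : (w : Word k n) → m ≤ k → DescentTops≥ m w → m ≤ leastTop w
m≤leastTop⁺ []      m≤k d = m≤k
m≤leastTop⁺ (i ∷ w) m≤k d with any? (Fin._<? i) w
... | yes p = ⊓-glb (d zero (suc (VecAny.index p)) (s≤s z≤n) (VecAny.lookup-index p))
                    (m≤leastTop⁺ w m≤k (DescentTops≥-tail {w = w} d))
... | no _  = m≤leastTop⁺ w m≤k (DescentTops≥-tail {w = w} d)

m≤leastTop⁻ : (w : Word k n) → m ≤ leastTop w → DescentTops≥ m w
m≤leastTop⁻ (i ∷ w) m≤ with any? (Fin._<? i) w
... | yes p = DescentTops≥-∷ i w (≤-trans m≤ (m⊓n≤m _ _)) (m≤leastTop⁻ w (≤-trans m≤ (m⊓n≤n (toℕ i) _)))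
... | no ¬p = λ where
  zero    (suc c) a<c       lt → contradiction (toAny (∈ᵥ-lookup c w) lt) ¬p
  (suc a) (suc c) (s≤s a<c) lt → m≤leastTop⁻ w m≤ a c a<c lt

-- A 321 that starts at `i` needs a 21-pattern of `w` with top below `i`.
Avoids321-∷⁺ : ∀ i (w : Word k n) → toℕ i ≤ leastTop w → Avoids321 w → Avoids321 (i ∷ w)
Avoids321-∷⁺ i w i≤ av zero    (suc b) (suc c) _         (s≤s b<c) lt lt′ =
  <⇒≱ lt (m≤leastTop⁻ w i≤ b c b<c lt′)
Avoids321-∷⁺ i w i≤ av (suc a) (suc b) (suc c) (s≤s a<b) (s≤s b<c) = av a b c a<b b<c

Avoids321-∷⁻ : ∀ i (w : Word k n) → Avoids321 (i ∷ w) → toℕ i ≤ leastTop w × Avoids321 w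
Avoids321-∷⁻ i w av =
  m≤leastTop⁺ w (<⇒≤ (Fin.toℕ<n i)) (λ b c b<c lt → ≮⇒≥ λ b<i →
    av zero (suc b) (suc c) (s≤s z≤n) (s≤s b<c) b<i lt) ,
  λ a b c a<b b<c → av (suc a) (suc b) (suc c) (s≤s a<b) (s≤s b<c)

-- Shifting letters to make room for a new one

punchIn-mono-< : ∀ i (j l : Fin k) → j Fin.< l → punchIn i j Fin.< punchIn i l
punchIn-mono-< i j l j<l = ≰⇒> (<⇒≱ j<l ∘ Fin.punchIn-cancel-≤ i l j)

punchIn-cancel-< : ∀ i (j l : Fin k) → punchIn i j Fin.< punchIn i l → j Fin.< l
punchIn-cancel-< i j l lt = ≰⇒> (<⇒≱ lt ∘ Fin.punchIn-mono-≤ i l j)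

i≤punchIn⁺ : ∀ i (j : Fin k) → toℕ i ≤ toℕ j → toℕ i ≤ toℕ (punchIn i j)
i≤punchIn⁺ zero    j       _         = z≤n
i≤punchIn⁺ (suc i) (suc j) (s≤s i≤j) = s≤s (i≤punchIn⁺ i j i≤j)

i≤punchIn⁻ : ∀ i (j : Fin k) → toℕ i ≤ toℕ (punchIn i j) → toℕ i ≤ toℕ j
i≤punchIn⁻ zero    j       _        = z≤n
i≤punchIn⁻ (suc i) (suc j) (s≤s le) = s≤s (i≤punchIn⁻ i j le)

module _ (i : Fin (suc k)) (w : Word k n) where

  private
    w↑ : Word (suc k) n
    w↑ = Vec.map (punchIn i) w

    lookup↑ : ∀ a → lookup w↑ a ≡ punchIn i (lookup w a)
    lookup↑ a = lookup-map a (punchIn i) w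

    <↑⁺ : ∀ a b → lookup w a Fin.< lookup w b → lookup w↑ a Fin.< lookup w↑ b
    <↑⁺ a b lt rewrite lookup↑ a | lookup↑ b = punchIn-mono-< i _ _ lt

    <↑⁻ : ∀ a b → lookup w↑ a Fin.< lookup w↑ b → lookup w a Fin.< lookup w b
    <↑⁻ a b lt rewrite lookup↑ a | lookup↑ b = punchIn-cancel-< i _ _ lt

  Avoids321-punchIn⁺ : Avoids321 w → Avoids321 w↑
  Avoids321-punchIn⁺ av a b c a<b b<c lt lt′ = av a b c a<b b<c (<↑⁻ b a lt) (<↑⁻ c b lt′)

  Avoids321-punchIn⁻ : Avoids321 w↑ → Avoids321 w
  Avoids321-punchIn⁻ av a b c a<b b<c lt lt′ = av a b c a<b b<c (<↑⁺ b a lt) (<↑⁺ c b lt′)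

  -- `punchIn i` preserves both the 21-patterns and the relation of each letter to the threshold
  -- `i`, so the test for prepending `i` can be made before or after the shift.
  i≤leastTop-punchIn⁺ : toℕ i ≤ leastTop w → toℕ i ≤ leastTop w↑
  i≤leastTop-punchIn⁺ i≤ = m≤leastTop⁺ w↑ (<⇒≤ (Fin.toℕ<n i)) λ a c a<c lt →
    subst (λ x → toℕ i ≤ toℕ x) (sym (lookup↑ a))
      (i≤punchIn⁺ i _ (m≤leastTop⁻ w i≤ a c a<c (<↑⁻ c a lt)))

  i≤leastTop-punchIn⁻ : toℕ i ≤ leastTop w↑ → toℕ i ≤ leastTop w
  i≤leastTop-punchIn⁻ i≤ = m≤leastTop⁺ w (Fin.toℕ≤pred[n] i) λ a c a<c lt →
    i≤punchIn⁻ i _ (subst (λ x → toℕ i ≤ toℕ x) (lookup↑ a)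
      (m≤leastTop⁻ w↑ i≤ a c a<c (<↑⁺ c a lt)))

leastTop-map-suc : (w : Word k n) → leastTop (Vec.map suc w) ≡ suc (leastTop w)
leastTop-map-suc w = ≤-antisym (upper _ ≤-refl) lower
  where
  -- The bound is a variable so that it can be split: only a successor bound passes down to `w`.
  upper : ∀ m → m ≤ leastTop (Vec.map suc w) → m ≤ suc (leastTop w)
  upper zero    _  = z≤n
  upper (suc m) m≤ = s≤s (m≤leastTop⁺ w (s≤s⁻¹ (≤-trans m≤ (leastTop≤k (Vec.map suc w)))) λ a c a<c lt →
    s≤s⁻¹ (subst (λ x → suc m ≤ toℕ x) (lookup-map a suc w) (m≤leastTop⁻ (Vec.map suc w) m≤ a c a<c
      (subst₂ Fin._<_ (sym (lookup-map c suc w)) (sym (lookup-map a suc w)) (s≤s lt)))))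
  lower : suc (leastTop w) ≤ leastTop (Vec.map suc w)
  lower = m≤leastTop⁺ (Vec.map suc w) (s≤s (leastTop≤k w)) λ a c a<c lt →
    subst (λ x → suc (leastTop w) ≤ toℕ x) (sym (lookup-map a suc w)) (s≤s (m≤leastTop⁻ w ≤-refl a c a<c
      (s≤s⁻¹ (subst₂ Fin._<_ (lookup-map c suc w) (lookup-map a suc w) lt))))

leastTop-zero∷ : (w : Word (suc k) n) → leastTop (zero ∷ w) ≡ leastTop w
leastTop-zero∷ w = ≤-antisym
  (m≤leastTop⁺ w (leastTop≤k (zero ∷ w)) (DescentTops≥-tail {w = w} (m≤leastTop⁻ (zero ∷ w) ≤-refl)))
  (m≤leastTop⁺ (zero ∷ w) (leastTop≤k w) λ where
    (suc a) (suc c) (s≤s a<c) lt → m≤leastTop⁻ w ≤-refl a c a<c lt)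

-- The occurrence of `zero` in `w` makes the first letter the top of a 21-pattern, and the other
-- tops are no smaller. The counting needs surjectivity for this.
leastTop-suc∷ : ∀ i (w : Word (suc k) n) → zero ∈ᵥ w → suc (toℕ i) ≤ leastTop w →
                leastTop (suc i ∷ w) ≡ suc (toℕ i)
leastTop-suc∷ i w 0∈w i≤ = ≤-antisym
  (m≤leastTop⁻ (suc i ∷ w) ≤-refl zero (suc (VecAny.index 0∈w)) (s≤s z≤n)
    (subst (Fin._< suc i) (VecAny.lookup-index 0∈w) (s≤s z≤n)))
  (m≤leastTop⁺ (suc i ∷ w) (≤-trans i≤ (leastTop≤k w))
    (DescentTops≥-∷ (suc i) w ≤-refl (m≤leastTop⁻ w i≤)))

insert : Fin (suc k) → Word k n → Word (suc k) (suc n)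
insert i w = i ∷ Vec.map (punchIn i) w

leastTop-insert-zero : (w : Word k n) → leastTop (insert zero w) ≡ suc (leastTop w)
leastTop-insert-zero w = trans (leastTop-zero∷ (Vec.map suc w)) (leastTop-map-suc w)

leastTop-insert-suc : (i : Fin k) (w : Word k n) → Surjective w → suc (toℕ i) ≤ leastTop w →
                      leastTop (insert (suc i) w) ≡ suc (toℕ i)
leastTop-insert-suc {suc k} i w surj i≤ = leastTop-suc∷ i _ (∈ᵥ-map⁺ (punchIn (suc i)) (surj zero))
  (i≤leastTop-punchIn⁺ (suc i) w i≤)

-- Enumeration of the surjective 321-avoiding words

-- `m` may exceed `k`: if `w` has no 21-pattern, `merges` asks for `suc k` letters and gets all `k`.
below : (k m : ℕ) → List (Fin k)
below zero    m       = []
below (suc k) zero    = []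
below (suc k) (suc m) = zero ∷ List.map suc (below k m)

∈-below⁺ : (i : Fin k) → toℕ i < m → i ∈ below k m
∈-below⁺ zero    (s≤s _)   = here refl
∈-below⁺ (suc i) (s≤s i<m) = there (∈-map⁺ suc (∈-below⁺ i i<m))

∈-below⁻ : (i : Fin k) → i ∈ below k m → toℕ i < m
∈-below⁻ {m = suc m} zero    _         = s≤s z≤n
∈-below⁻ {m = suc m} (suc i) (there p) with _ , j∈ , refl ← ∈-map⁻ suc p = s≤s (∈-below⁻ i j∈)

below-unique : ∀ k m → Unique (below k m)
below-unique zero    m       = []
below-unique (suc k) zero    = []
below-unique (suc k) (suc m) =
  All.map⁺ (All.universal (λ _ ()) _) ∷ Unique.map⁺ Fin.suc-injective (below-unique k m)

inserts : Word k n → List (Word (suc k) (suc n))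
inserts w = List.map (λ i → insert i w) (below _ (suc (leastTop w)))

merges : Word k n → List (Word k (suc n))
merges w = List.map (_∷ w) (below _ (suc (leastTop w)))

-- The first letter of a nonempty word either does not recur (`inserts`) or does (`merges`), and
-- this decides whether the tail uses one letter less.
words : (k n : ℕ) → List (Word k n)
words zero    zero    = [] ∷ []
words zero    (suc n) = []
words (suc k) zero    = []
words (suc k) (suc n) = concatMap inserts (words k n) ++ concatMap merges (words (suc k) n)

map-injective : {f : A → B} → (∀ {x y} → f x ≡ f y → x ≡ y) →
                {xs ys : Vec A n} → Vec.map f xs ≡ Vec.map f ys → xs ≡ ys
map-injective inj {[]}     {[]}     _  = refl
map-injective inj {x ∷ xs} {y ∷ ys} eq with eq₁ , eq₂ ← ∷-injective eq =
  cong₂ _∷_ (inj eq₁) (map-injective inj eq₂)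

insert-injective : ∀ {i j} {v w : Word k n} → insert i v ≡ insert j w → i ≡ j × v ≡ w
insert-injective eq with refl , eq₂ ← ∷-injective eq =
  refl , map-injective (Fin.punchIn-injective _ _ _) eq₂

∉-map-punchIn : ∀ i (w : Word k n) → ¬ (i ∈ᵥ Vec.map (punchIn i) w)
∉-map-punchIn i (j ∷ w) (here eq) = Fin.punchInᵢ≢i i j (sym eq)
∉-map-punchIn i (j ∷ w) (there p) = ∉-map-punchIn i w p

∉⇒map-punchIn : ∀ i (w : Word (suc k) n) → ¬ (i ∈ᵥ w) → ∃[ v ] w ≡ Vec.map (punchIn i) v
∉⇒map-punchIn i []      i∉w = [] , refl
∉⇒map-punchIn i (j ∷ w) i∉w with v , refl ← ∉⇒map-punchIn i w (i∉w ∘ there) =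
  punchOut (i∉w ∘ here) ∷ v , cong (_∷ _) (sym (Fin.punchIn-punchOut (i∉w ∘ here)))

Surjective-insert⁺ : ∀ i (w : Word k n) → Surjective w → Surjective (insert i w)
Surjective-insert⁺ i w surj j with i Fin.≟ j
... | yes refl = here refl
... | no  i≢j  = there (subst (_∈ᵥ _) (Fin.punchIn-punchOut i≢j) (∈ᵥ-map⁺ (punchIn i) (surj _)))

Surjective-insert⁻ : ∀ i (w : Word k n) → Surjective (insert i w) → Surjective w
Surjective-insert⁻ i w surj j with surj (punchIn i j)
... | here eq = contradiction eq (Fin.punchInᵢ≢i i j)
... | there p = VecAny.map (Fin.punchIn-injective i _ _) (VecAny.map⁻ p)

Surjective-∷⁻ : ∀ i (w : Word k n) → i ∈ᵥ w → Surjective (i ∷ w) → Surjective w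
Surjective-∷⁻ i w i∈w surj j with surj j
... | here refl = i∈w
... | there p   = p

words-sound : ∀ k n {w : Word k n} → w ∈ words k n → Surjective w × Avoids321 w
words-sound zero    zero    {[]} _ = (λ ()) , λ ()
words-sound (suc k) (suc n) w∈ with ∈-++⁻ (concatMap inserts (words k n)) w∈
... | inj₁ p with v , v∈ , q ← find (∈-concatMap⁻ inserts {words k n} p)
             with i , i∈ , refl ← ∈-map⁻ _ q
             with surj , av ← words-sound k n v∈ =
  Surjective-insert⁺ i v surj ,
  Avoids321-∷⁺ i _ (i≤leastTop-punchIn⁺ i v (s≤s⁻¹ (∈-below⁻ i i∈))) (Avoids321-punchIn⁺ i v av)
... | inj₂ p with v , v∈ , q ← find (∈-concatMap⁻ merges {words (suc k) n} p)
             with i , i∈ , refl ← ∈-map⁻ _ q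
             with surj , av ← words-sound (suc k) n v∈ =
  there ∘ surj , Avoids321-∷⁺ i v (s≤s⁻¹ (∈-below⁻ i i∈)) av

words-complete : ∀ k n (w : Word k n) → Surjective w → Avoids321 w → w ∈ words k n
words-complete zero    zero    []      _    _  = here refl
words-complete (suc k) zero    []      surj _  with () ← surj zero
words-complete (suc k) (suc n) (i ∷ w) surj av with any? (i Fin.≟_) w
... | yes i∈w with i≤ , av′ ← Avoids321-∷⁻ i w av =
  ∈-++⁺ʳ _ (∈-concatMap⁺ merges (lose (words-complete (suc k) n w (Surjective-∷⁻ i w i∈w surj) av′)
    (∈-map⁺ (_∷ w) (∈-below⁺ i (s≤s i≤)))))
... | no i∉w with v , refl ← ∉⇒map-punchIn i w i∉w
             with i≤ , av′ ← Avoids321-∷⁻ i w av =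
  ∈-++⁺ˡ (∈-concatMap⁺ inserts
    (lose (words-complete k n v (Surjective-insert⁻ i v surj) (Avoids321-punchIn⁻ i v av′))
      (∈-map⁺ (λ i → insert i v) (∈-below⁺ i (s≤s (i≤leastTop-punchIn⁻ i v i≤))))))

concatMap-unique : (f : A → List B) → (∀ x → Unique (f x)) →
                   (∀ {x x′ y} → y ∈ f x → y ∈ f x′ → x ≡ x′) →
                   {xs : List A} → Unique xs → Unique (concatMap f xs)
concatMap-unique f f! disj xs! = Unique.concat⁺ (All.map⁺ (All.universal f! _))
  (AllPairs.map⁺ (AllPairs.map (λ x≢x′ {_} (p , q) → x≢x′ (disj p q)) xs!))

words-unique : ∀ k n → Unique (words k n)
words-unique zero    zero    = [] ∷ []
words-unique zero    (suc n) = []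
words-unique (suc k) zero    = []
words-unique (suc k) (suc n) = Unique.++⁺
  (concatMap-unique inserts (λ w → Unique.map⁺ (proj₁ ∘ insert-injective) (below-unique _ _))
    disj-inserts (words-unique k n))
  (concatMap-unique merges (λ w → Unique.map⁺ (proj₁ ∘ ∷-injective) (below-unique _ _))
    disj-merges (words-unique (suc k) n))
  disj
  where
  disj-inserts : ∀ {v v′ : Word k n} {w} → w ∈ inserts v → w ∈ inserts v′ → v ≡ v′
  disj-inserts p q with _ , _ , eq ← ∈-map⁻ _ p with _ , _ , eq′ ← ∈-map⁻ _ q =
    proj₂ (insert-injective (trans (sym eq) eq′))
  disj-merges : ∀ {v v′ : Word (suc k) n} {w} → w ∈ merges v → w ∈ merges v′ → v ≡ v′
  disj-merges p q with _ , _ , eq ← ∈-map⁻ _ p with _ , _ , eq′ ← ∈-map⁻ _ q =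
    proj₂ (∷-injective (trans (sym eq) eq′))
  disj : ∀ {w} → ¬ (w ∈ concatMap inserts (words k n) × w ∈ concatMap merges (words (suc k) n))
  disj (p , q) with v , _ , p′ ← find (∈-concatMap⁻ inserts {words k n} p)
               with v′ , v′∈ , q′ ← find (∈-concatMap⁻ merges {words (suc k) n} q)
               with i , _ , refl ← ∈-map⁻ _ p′
               with _ , _ , eq ← ∈-map⁻ _ q′
               with refl , refl ← ∷-injective eq =
    -- After an insertion the tail omits `i`, whereas a merge starts from a surjective tail.
    ∉-map-punchIn i v (proj₁ (words-sound (suc k) n v′∈) i)

-- Words as ordered partitions

lookup-ext : {xs ys : Vec A n} → (∀ i → lookup xs i ≡ lookup ys i) → xs ≡ ys
lookup-ext {xs = xs} {ys} eq =
  trans (sym (tabulate∘lookup xs)) (trans (tabulate-cong eq) (tabulate∘lookup ys))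

opposite-injective : {i j : Fin k} → opposite i ≡ opposite j → i ≡ j
opposite-injective {i = i} {j} eq =
  trans (sym (Fin.opposite-involutive i)) (trans (cong opposite eq) (Fin.opposite-involutive j))

opposite-anti-< : {i j : Fin k} → i Fin.< j → opposite j Fin.< opposite i
opposite-anti-< {k} {i} {j} i<j = subst₂ _<_ (sym (Fin.opposite-prop j)) (sym (Fin.opposite-prop i))
  (∸-monoʳ-< (s≤s i<j) (Fin.toℕ<n j))

-- The letters of a word are block indices counted from the last block, which turns 123 into 321.
blocks : Word k n → Vec (Subset n) k
blocks w = tabulate λ i → tabulate λ x → does (lookup w x Fin.≟ opposite i)

lookup-blocks : ∀ (w : Word k n) i x → lookup (lookup (blocks w) i) x ≡ does (lookup w x Fin.≟ opposite i)
lookup-blocks w i x = trans (cong (λ p → lookup p x) (lookup∘tabulate _ i)) (lookup∘tabulate _ x)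

∈-blocks⁺ : ∀ (w : Word k n) {i x} → lookup w x ≡ opposite i → x Subset.∈ lookup (blocks w) i
∈-blocks⁺ w {i} {x} eq = lookup⇒[]= x _
  (trans (lookup-blocks w i x) (dec-true (lookup w x Fin.≟ opposite i) eq))

∈-blocks⁻ : ∀ (w : Word k n) {i x} → x Subset.∈ lookup (blocks w) i → lookup w x ≡ opposite i
∈-blocks⁻ w {i} {x} x∈ with lookup w x Fin.≟ opposite i | trans (sym (lookup-blocks w i x)) ([]=⇒lookup x∈)
... | yes eq | _ = eq
... | no  _  | ()

∈-blocks-opposite : ∀ (w : Word k n) x → x Subset.∈ lookup (blocks w) (opposite (lookup w x))
∈-blocks-opposite w x = ∈-blocks⁺ w (sym (Fin.opposite-involutive (lookup w x)))

blocks-injective : {v w : Word k n} → blocks v ≡ blocks w → v ≡ w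
blocks-injective {v = v} {w} eq = lookup-ext λ x → sym (trans
  (∈-blocks⁻ w (subst (λ B → x Subset.∈ lookup B (opposite (lookup v x))) eq (∈-blocks-opposite v x)))
  (Fin.opposite-involutive (lookup v x)))

blocks-isOrderedPartition : (w : Word k n) → Surjective w → IsOrderedPartition (blocks w)
blocks-isOrderedPartition w surj = record
  { nonempty = λ i → VecAny.index (surj (opposite i)) ,
                     ∈-blocks⁺ w (sym (VecAny.lookup-index (surj (opposite i))))
  ; disjoint = λ i j i≢j (x , x∈) → let x∈i , x∈j = x∈p∩q⁻ _ _ x∈ in
                 i≢j (opposite-injective (trans (sym (∈-blocks⁻ w x∈i)) (∈-blocks⁻ w x∈j)))
  ; covering = λ x → opposite (lookup w x) , ∈-blocks-opposite w x
  }

blocks-surjective : (B : Vec (Subset n) k) → IsOrderedPartition B → ∃[ w ] blocks w ≡ B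
blocks-surjective B isP = w , lookup-ext λ i → ⊆-antisym blocks⊆B B⊆blocks
  where
  open IsOrderedPartition isP
  w : Word _ _
  w = tabulate λ x → opposite (proj₁ (covering x))
  lookup-w : ∀ x → lookup w x ≡ opposite (proj₁ (covering x))
  lookup-w = lookup∘tabulate _
  blocks⊆B : ∀ {i x} → x Subset.∈ lookup (blocks w) i → x Subset.∈ lookup B i
  blocks⊆B {i} {x} x∈ = subst (λ i → x Subset.∈ lookup B i)
    (opposite-injective (trans (sym (lookup-w x)) (∈-blocks⁻ w x∈))) (proj₂ (covering x))
  B⊆blocks : ∀ {i x} → x Subset.∈ lookup B i → x Subset.∈ lookup (blocks w) i
  -- `covering` picks one block containing `x`; disjointness leaves no other.
  B⊆blocks {i} {x} x∈ with proj₁ (covering x) Fin.≟ i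
  ... | yes eq = ∈-blocks⁺ w (trans (lookup-w x) (cong opposite eq))
  ... | no neq = contradiction (x , x∈p∩q⁺ (proj₂ (covering x) , x∈)) (disjoint _ i neq)

Surjective-blocks⁻ : (w : Word k n) → IsOrderedPartition (blocks w) → Surjective w
Surjective-blocks⁻ w isP j with x , x∈ ← IsOrderedPartition.nonempty isP (opposite j) =
  subst (_∈ᵥ w) (trans (∈-blocks⁻ w x∈) (Fin.opposite-involutive j)) (∈ᵥ-lookup x w)

triple-increasing : (xs : Vec (Fin n) 3) → lookup xs zero Fin.< lookup xs (suc zero) →
                    lookup xs (suc zero) Fin.< lookup xs (suc (suc zero)) → StrictlyIncreasing xs
triple-increasing (a ∷ b ∷ c ∷ []) a<b b<c = λ where
  zero       (suc zero)       _ → a<b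
  zero       (suc (suc zero)) _ → <-trans a<b b<c
  (suc zero) (suc (suc zero)) _ → b<c
  (suc zero) (suc zero) (s≤s ())
  (suc (suc zero)) (suc zero) (s≤s ())
  (suc (suc zero)) (suc (suc zero)) (s≤s (s≤s ()))

increasing-cancel-< : (xs : Vec (Fin n) m) → StrictlyIncreasing xs →
                             ∀ a c → lookup xs a Fin.< lookup xs c → a Fin.< c
increasing-cancel-< xs inc a c lt with Fin.<-cmp a c
... | tri< a<c _ _  = a<c
... | tri≈ _ refl _ = contradiction lt (<-irrefl refl)
... | tri> _ _ c<a  = contradiction lt (<-asym (inc c a c<a))

-- Elements and block indices swap roles: the elements of a 123 are the positions of a 321, and its
-- block indices, reversed by `opposite`, are the letters.
Avoids-blocks⁺ : (w : Word k n) → Avoids321 w → Avoids (blocks w) ρ₁₂₃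
Avoids-blocks⁺ w av (is , bs , inc , ∈B , iso) = av (b 0F) (b 1F) (b 2F)
  (Equivalence.from (iso 0F 1F) (s≤s z≤n)) (Equivalence.from (iso 1F 2F) (s≤s (s≤s z≤n)))
  (desc 0F 1F (s≤s z≤n)) (desc 1F 2F (s≤s (s≤s z≤n)))
  where
  b = lookup bs
  desc : ∀ i j → i Fin.< j → lookup w (b j) Fin.< lookup w (b i)
  desc i j i<j = subst₂ Fin._<_ (sym (∈-blocks⁻ w (∈B j))) (sym (∈-blocks⁻ w (∈B i)))
    (opposite-anti-< (inc i j i<j))

Avoids-blocks⁻ : (w : Word k n) → Avoids (blocks w) ρ₁₂₃ → Avoids321 w
Avoids-blocks⁻ w av a b c a<b b<c lt lt′ = av
  (Vec.map f xs , xs ,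
   triple-increasing (Vec.map f xs) (opposite-anti-< lt) (opposite-anti-< lt′) ,
   (λ j → subst (λ i → lookup xs j Subset.∈ lookup (blocks w) i) (sym (lookup-map j f xs))
            (∈-blocks-opposite w (lookup xs j))) ,
   λ i j → mk⇔ (increasing-cancel-< xs inc i j) (inc i j))
  where
  f = opposite ∘ lookup w
  xs = a ∷ b ∷ c ∷ []
  inc = triple-increasing xs a<b b<c

-- Two duplicate-free lists with the same members are permutations of each other.
op≡length-words : ∀ n k → op n k ρ₁₂₃ ≡ length (words k n)
op≡length-words n k = trans
  (↭-length (∼bag⇒↭ (unique∧set⇒bag
    (Unique.filter⁺ P? (blockSequences-unique n k))
    (Unique.map⁺ blocks-injective (words-unique k n))
    (mk⇔ to from))))
  (length-map blocks (words k n))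
  where
  P? = λ (B : Vec (Subset n) k) → isOrderedPartition? B ×-dec avoids? ρ₁₂₃ B
  to : ∀ {B} → B ∈ filter P? (blockSequences n k) → B ∈ List.map blocks (words k n)
  to {B} B∈ with _ , isP , av ← ∈-filter⁻ P? {xs = blockSequences n k} B∈
            with w , refl ← blocks-surjective B isP =
    ∈-map⁺ blocks (words-complete k n w (Surjective-blocks⁻ w isP) (Avoids-blocks⁻ w av))
  from : ∀ {B} → B ∈ List.map blocks (words k n) → B ∈ filter P? (blockSequences n k)
  from B∈ with w , w∈ , refl ← ∈-map⁻ blocks B∈ with surj , av ← words-sound k n w∈ =
    ∈-filter⁺ P? (blockSequences-complete (blocks w))
      (blocks-isOrderedPartition w surj , Avoids-blocks⁺ w av)

-- Counting descendants in the generating tree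

Σ< : ℕ → (ℕ → ℕ) → ℕ
Σ< zero    f = 0
Σ< (suc n) f = Σ< n f + f n

Σ<-front : ∀ n f → Σ< (suc n) f ≡ f 0 + Σ< n (f ∘ suc)
Σ<-front zero    f = sym (+-identityʳ (f 0))
Σ<-front (suc n) f = trans (cong (_+ f (suc n)) (Σ<-front n f)) (+-assoc (f 0) _ _)

Σ<-cong : ∀ n {f g : ℕ → ℕ} → (∀ i → i < n → f i ≡ g i) → Σ< n f ≡ Σ< n g
Σ<-cong zero    eq = refl
Σ<-cong (suc n) eq = cong₂ _+_ (Σ<-cong n λ i i<n → eq i (m<n⇒m<1+n i<n)) (eq n ≤-refl)

-- Sums `f` over the new values of `leastTop`: inserting the letter 0 gives `suc s`, and each letter
-- from 1 to `s` gives itself.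
overInserts : (ℕ → ℕ) → ℕ → ℕ
overInserts f s = f (suc s) + Σ< s (f ∘ suc)

-- The leastTop of i ∷ w when leastTop w is s and i is a letter of w with i ≤ s.
mergeTop : ℕ → ℕ → ℕ
mergeTop s zero    = s
mergeTop s (suc i) = suc i

-- The minimum matters only at `s = k`, where the letter `k` does not exist.
overMerges : ℕ → (ℕ → ℕ) → ℕ → ℕ
overMerges k f s = Σ< (suc s ⊓ k) (f ∘ mergeTop s)

-- The number of ways to extend a word with leastTop s by j new letters.
ext : ℕ → ℕ → ℕ
ext zero    s = 1
ext (suc j) s = overInserts (ext j) s

-- The number of ways to extend a word over k letters with leastTop s by j letters,
-- exactly one of them a repetition.
ext₁ : ℕ → ℕ → ℕ → ℕ
ext₁ zero    k s = 0
ext₁ (suc j) k s = overMerges k (ext j) s + overInserts (ext₁ j (suc k)) s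

-- The value of ext₁ j k s for s < k, where it does not depend on k.
ext₁∞ : ℕ → ℕ → ℕ
ext₁∞ zero    s = 0
ext₁∞ (suc j) s = (ext j s + Σ< s (ext j ∘ suc)) + overInserts (ext₁∞ j) s

overMerges-< : ∀ k f s → s < k → overMerges k f s ≡ f s + Σ< s (f ∘ suc)
overMerges-< k f s s<k = trans (cong (λ l → Σ< l (f ∘ mergeTop s)) (m≤n⇒m⊓n≡m s<k)) (Σ<-front s _)

overMerges-≡ : ∀ k f → overMerges k f k ≡ Σ< k (f ∘ suc)
overMerges-≡ zero    f = refl
overMerges-≡ (suc k) f = begin
  Σ< (suc (suc k) ⊓ suc k) (f ∘ mergeTop (suc k))
    ≡⟨ cong (λ l → Σ< l (f ∘ mergeTop (suc k))) (m≥n⇒m⊓n≡n (n≤1+n (suc k))) ⟩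
  Σ< (suc k) (f ∘ mergeTop (suc k))
    ≡⟨ Σ<-front k _ ⟩
  f (suc k) + Σ< k (f ∘ suc)
    ≡⟨ +-comm (f (suc k)) _ ⟩
  Σ< (suc k) (f ∘ suc) ∎

-- An insertion raises `k` by one and `s` by at most one, so `s < k` persists and the truncation in
-- `overMerges` never takes effect.
ext₁-< : ∀ j k s → s < k → ext₁ j k s ≡ ext₁∞ j s
ext₁-< zero    k s s<k = refl
ext₁-< (suc j) k s s<k = cong₂ _+_ (overMerges-< k (ext j) s s<k)
  (cong₂ _+_ (ext₁-< j (suc k) (suc s) (s≤s s<k))
             (Σ<-cong s λ i i<s → ext₁-< j (suc k) (suc i) (s≤s (<-trans i<s s<k))))

-- The last summand on the left is the leading term of `ext (suc j) s`.
ext-suc : ∀ j s → ext (suc j) (suc s) ≡ ext (suc j) s + ext j (suc (suc s))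
ext-suc j s = lemma (ext j (suc (suc s))) (Σ< s (ext j ∘ suc)) (ext j (suc s))
  where
  lemma : ∀ a b c → a + (b + c) ≡ (c + b) + a
  lemma = solve-∀

-- Only inserting 0 keeps `s = k`. Along that branch each merge count lacks the one term `ext i s`,
-- and by `ext-suc` these terms telescope to `ext j (suc k)`.
ext₁-≡ : ∀ j k → ext₁ (suc j) k k + ext j (suc k) ≡ ext₁∞ (suc j) k
ext₁-≡ zero    k rewrite overMerges-≡ k (λ _ → 1) = lemma (Σ< k (λ _ → 1)) (Σ< k (λ _ → 0))
  where
  lemma : ∀ a b → a + b + 1 ≡ suc (a + b)
  lemma = solve-∀
ext₁-≡ (suc j) k = begin
  overMerges k (ext (suc j)) k + (ext₁ (suc j) (suc k) (suc k) + Σ< k (ext₁ (suc j) (suc k) ∘ suc))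
    + ext (suc j) (suc k)
    ≡⟨ cong₂ (λ a b → a + (ext₁ (suc j) (suc k) (suc k) + b) + ext (suc j) (suc k))
         (overMerges-≡ k (ext (suc j)))
         (Σ<-cong k λ i i<k → ext₁-< (suc j) (suc k) (suc i) (s≤s i<k)) ⟩
  P + (ext₁ (suc j) (suc k) (suc k) + Q) + ext (suc j) (suc k)
    -- Splits the deficit into the term lost at this letter and the deficit of the remaining branch.
    ≡⟨ cong (P + (ext₁ (suc j) (suc k) (suc k) + Q) +_) (ext-suc j k) ⟩
  P + (ext₁ (suc j) (suc k) (suc k) + Q) + (ext (suc j) k + ext j (suc (suc k)))
    ≡⟨ lemma P (ext₁ (suc j) (suc k) (suc k)) Q (ext (suc j) k) (ext j (suc (suc k))) ⟩
  (ext (suc j) k + P) + ((ext₁ (suc j) (suc k) (suc k) + ext j (suc (suc k))) + Q)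
    ≡⟨ cong (λ x → (ext (suc j) k + P) + (x + Q)) (ext₁-≡ j (suc k)) ⟩
  (ext (suc j) k + P) + (ext₁∞ (suc j) (suc k) + Q) ∎
  where
  P = Σ< k (ext (suc j) ∘ suc)
  Q = Σ< k (ext₁∞ (suc j) ∘ suc)
  lemma : ∀ p m q a b → p + (m + q) + (a + b) ≡ (a + p) + ((m + b) + q)
  lemma = solve-∀

-- Closed forms

-- paths a b is C(a + b, a), and paths⁻ a b is C(a + b - 1, a - 1), read as 0 for a = 0.
paths : ℕ → ℕ → ℕ
paths zero    b       = 1
paths (suc a) zero    = 1
paths (suc a) (suc b) = paths a (suc b) + paths (suc a) b

paths⁻ : ℕ → ℕ → ℕ
paths⁻ zero    b = 0
paths⁻ (suc a) b = paths a b

-- Pascal's rule, made uniform in `a` by the value 0 of `paths⁻` at 0.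
paths-suc : ∀ a b → paths a (suc b) ≡ paths⁻ a (suc b) + paths a b
paths-suc zero    b = refl
paths-suc (suc a) b = refl

paths-sym : ∀ a b → paths a b ≡ paths b a
paths-sym zero    zero    = refl
paths-sym zero    (suc b) = refl
paths-sym (suc a) zero    = refl
paths-sym (suc a) (suc b) = trans (cong₂ _+_ (paths-sym a (suc b)) (paths-sym (suc a) b))
                                  (+-comm (paths (suc b) a) _)

-- The absorption identity `(b + 1) C(a + b + 1, a) = (a + b + 1) C(a + b, a)`.
[1+b]*paths : ∀ a b → suc b * paths a (suc b) ≡ suc (a + b) * paths a b
[1+b]*paths zero    b       = refl
[1+b]*paths (suc a) zero    = begin
  1 * (paths a 1 + 1)  ≡⟨ lemma (paths a 1) ⟩
  1 * paths a 1 + 1    ≡⟨ cong (_+ 1) ([1+b]*paths a 0) ⟩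
  suc (a + 0) * paths a 0 + 1 ≡⟨ cong (λ x → suc (a + 0) * x + 1) (paths-sym a 0) ⟩
  suc (a + 0) * 1 + 1  ≡⟨ lemma′ a ⟩
  suc (suc a + 0) * 1  ∎
  where
  lemma : ∀ x → 1 * (x + 1) ≡ 1 * x + 1
  lemma = solve-∀
  lemma′ : ∀ a → suc (a + 0) * 1 + 1 ≡ suc (suc a + 0) * 1
  lemma′ = solve-∀
[1+b]*paths (suc a) (suc b) = begin
  suc (suc b) * (paths a (suc (suc b)) + (x + y))
    ≡⟨ lemma b (paths a (suc (suc b))) x y ⟩
  suc (suc b) * paths a (suc (suc b)) + (suc b * (x + y) + (x + y))
    ≡⟨ cong₂ (λ u v → u + (v + (x + y))) ([1+b]*paths a (suc b)) ([1+b]*paths (suc a) b) ⟩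
  suc (a + suc b) * x + (suc (suc a + b) * y + (x + y))
    ≡⟨ lemma′ a b x y ⟩
  suc (suc a + suc b) * (x + y) ∎
  where
  x = paths a (suc b)
  y = paths (suc a) b
  lemma : ∀ b p x y → suc (suc b) * (p + (x + y)) ≡ suc (suc b) * p + (suc b * (x + y) + (x + y))
  lemma = solve-∀
  lemma′ : ∀ a b x y → suc (a + suc b) * x + (suc (suc a + b) * y + (x + y)) ≡ suc (suc a + suc b) * (x + y)
  lemma′ = solve-∀

[1+a]*paths : ∀ a b → suc a * paths (suc a) b ≡ suc (a + b) * paths a b
[1+a]*paths a b = begin
  suc a * paths (suc a) b  ≡⟨ cong (suc a *_) (paths-sym (suc a) b) ⟩
  suc a * paths b (suc a)  ≡⟨ [1+b]*paths b a ⟩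
  suc (b + a) * paths b a  ≡⟨ cong₂ (λ x y → suc x * y) (+-comm b a) (paths-sym b a) ⟩
  suc (a + b) * paths a b  ∎

-- `ext j s` is the ballot number `C(2j + s, j) - C(2j + s, j - 1)`, a Catalan number for `s = 0`.
-- The recurrence `ext-suc` matches Pascal's rule.
ext-closed : ∀ j s → ext j s + paths⁻ j (suc (j + s)) ≡ paths j (j + s)
ext-closed zero    s    = refl
ext-closed (suc j) zero rewrite +-identityʳ j = begin
  ext j 1 + 0 + paths j (2 + j)
    ≡⟨ cong (ext j 1 + 0 +_) (paths-suc j (suc j)) ⟩
  ext j 1 + 0 + (paths⁻ j (2 + j) + paths j (suc j))
    ≡⟨ lemma (ext j 1) (paths⁻ j (2 + j)) (paths j (suc j)) ⟩
  ext j 1 + paths⁻ j (2 + j) + paths j (suc j)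
    -- By symmetry the two halves of a central binomial coefficient agree.
    ≡⟨ cong₂ _+_ ih (paths-sym j (suc j)) ⟩
  paths j (suc j) + paths (suc j) j ∎
  where
  lemma : ∀ a b c → a + 0 + (b + c) ≡ a + b + c
  lemma = solve-∀
  ih : ext j 1 + paths⁻ j (2 + j) ≡ paths j (suc j)
  ih = subst (λ x → ext j 1 + paths⁻ j (suc x) ≡ paths j x) (+-comm j 1) (ext-closed j 1)
ext-closed (suc j) (suc s) = subst
  (λ x → ext (suc j) (suc s) + paths j (2 + x) ≡ paths (suc j) (suc x)) (sym (+-suc j s)) (begin
  ext (suc j) (suc s) + paths j (3 + t)
    ≡⟨ cong₂ _+_ (ext-suc j s) (paths-suc j (2 + t)) ⟩
  ext (suc j) s + ext j (2 + s) + (paths⁻ j (3 + t) + paths j (2 + t))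
    ≡⟨ lemma (ext (suc j) s) (ext j (2 + s)) (paths⁻ j (3 + t)) (paths j (2 + t)) ⟩
  (ext j (2 + s) + paths⁻ j (3 + t)) + (ext (suc j) s + paths j (2 + t))
    ≡⟨ cong₂ _+_ ih (ext-closed (suc j) s) ⟩
  paths j (2 + t) + paths (suc j) (suc t) ∎)
  where
  t = j + s
  lemma : ∀ a b c d → a + b + (c + d) ≡ (b + c) + (a + d)
  lemma = solve-∀
  ih : ext j (2 + s) + paths⁻ j (3 + t) ≡ paths j (2 + t)
  ih = subst (λ x → ext j (2 + s) + paths⁻ j (suc x) ≡ paths j x)
         (trans (+-suc j (suc s)) (cong suc (+-suc j s))) (ext-closed j (2 + s))

-- C(2j + s - 2, j - 2) + s C(2j + s - 2, j - 3), the amount by which ext₁∞ j s falls short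
-- of j * ext j s.
defect : ℕ → ℕ → ℕ
defect zero          s = 0
defect (suc zero)    s = 0
defect (suc (suc i)) s = paths i (2 + (i + s)) + s * paths⁻ i (3 + (i + s))

-- The shift `t` is moved to the front, where a numeral lets `paths` compute.
ext-closed+ : ∀ j t s → ext j (t + s) + paths⁻ j (suc (t + (j + s))) ≡ paths j (t + (j + s))
ext-closed+ j t s = subst (λ x → ext j (t + s) + paths⁻ j (suc x) ≡ paths j x)
  (lemma j t s) (ext-closed j (t + s))
  where
  lemma : ∀ j t s → j + (t + s) ≡ t + (j + s)
  lemma = solve-∀

defect-zero : ∀ j → ext j 0 + defect (suc j) 0 ≡ ext j 1 + defect j 1
defect-zero zero          = refl
defect-zero (suc zero)    = refl
defect-zero (suc (suc i)) = begin
  ext (2 + i) 0 + (paths (suc i) (3 + (i + 0)) + 0)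
    ≡⟨ cong (λ x → ext (2 + i) 0 + (paths (suc i) (3 + x) + 0)) (+-identityʳ i) ⟩
  ext (2 + i) 0 + (paths (suc i) (3 + i) + 0)
    ≡⟨ cong (λ x → ext (2 + i) 0 + (x + 0)) closed ⟨
  ext (2 + i) 0 + ((ext (suc i) 2 + paths i (4 + i)) + 0)
    ≡⟨ cong (λ x → ext (2 + i) 0 + ((ext (suc i) 2 + x) + 0)) (paths-suc i (3 + i)) ⟩
  ext (2 + i) 0 + ((ext (suc i) 2 + (paths⁻ i (4 + i) + paths i (3 + i))) + 0)
    ≡⟨ lemma (ext (2 + i) 0) (ext (suc i) 2) (paths⁻ i (4 + i)) (paths i (3 + i)) ⟩
  (ext (2 + i) 0 + ext (suc i) 2) + (paths i (3 + i) + 1 * paths⁻ i (4 + i))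
    ≡⟨ cong₂ _+_ (sym (ext-suc (suc i) 0))
         (cong (λ x → paths i (2 + x) + 1 * paths⁻ i (3 + x)) (sym (+-comm i 1))) ⟩
  ext (2 + i) 1 + (paths i (2 + (i + 1)) + 1 * paths⁻ i (3 + (i + 1))) ∎
  where
  lemma : ∀ a b c d → a + ((b + (c + d)) + 0) ≡ (a + b) + (d + 1 * c)
  lemma = solve-∀
  closed : ext (suc i) 2 + paths i (4 + i) ≡ paths (suc i) (3 + i)
  closed = subst (λ x → ext (suc i) 2 + paths i (4 + x) ≡ paths (suc i) (3 + x))
    (+-identityʳ i) (ext-closed+ (suc i) 2 0)

-- Pascal's rule on both coefficients leaves a spare `p`; `ext-closed+` splits it into
-- `ext i (4 + s)` and the `r` missing from `defect (2 + i) (2 + s)`.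
defect-suc-suc-suc : ∀ i s → defect (3 + i) (suc s) ≡
                     ext i (4 + s) + defect (3 + i) s + defect (2 + i) (2 + s)
defect-suc-suc-suc i s = begin
  paths (suc i) (3 + (i + suc s)) + suc s * paths i (4 + (i + suc s))
    ≡⟨ cong (λ x → paths (suc i) (3 + x) + suc s * paths i (4 + x)) (+-suc i s) ⟩
  (p + q) + suc s * paths i (5 + t)
    ≡⟨ cong (λ x → (p + q) + suc s * x) (paths-suc i (4 + t)) ⟩
  (p + q) + suc s * (r + p)
    ≡⟨ lemma p q r s ⟩
  q + s * p + p + suc s * r + p
    ≡⟨ cong (λ x → q + s * p + p + suc s * r + x) (ext-closed+ i 4 s) ⟨
  q + s * p + p + suc s * r + (ext i (4 + s) + r)
    ≡⟨ lemma′ p q r s (ext i (4 + s)) ⟩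
  ext i (4 + s) + (q + s * p) + (p + (2 + s) * r)
    ≡⟨ cong (λ x → ext i (4 + s) + (q + s * p) + (paths i (2 + x) + (2 + s) * paths⁻ i (3 + x))) (lemma″ i s) ⟨
  ext i (4 + s) + defect (3 + i) s + defect (2 + i) (2 + s) ∎
  where
  t = i + s
  p = paths i (4 + t)
  q = paths (suc i) (3 + t)
  r = paths⁻ i (5 + t)
  lemma : ∀ p q r s → (p + q) + suc s * (r + p) ≡ q + s * p + p + suc s * r + p
  lemma = solve-∀
  lemma′ : ∀ p q r s n → q + s * p + p + suc s * r + (n + r) ≡ n + (q + s * p) + (p + (2 + s) * r)
  lemma′ = solve-∀
  lemma″ : ∀ i s → i + (2 + s) ≡ 2 + (i + s)
  lemma″ = solve-∀

-- This is what the induction step of `ext₁∞-closed` demands of `defect`; `defect-zero` serves its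
-- case `s = 0`.
defect-suc : ∀ j s → 2 * ext j (1 + s) + defect (suc j) (suc s) ≡
             ext j (2 + s) + ext j s + defect (suc j) s + defect j (2 + s)
defect-suc zero          s = refl
defect-suc (suc zero)    s rewrite ext-suc 0 (suc s) | ext-suc 0 s = lemma (ext 1 s) s
  where
  lemma : ∀ n s → 2 * (n + 1) + (1 + suc s * 0) ≡ (n + 1 + 1) + n + (1 + s * 0) + 0
  lemma = solve-∀
defect-suc (suc (suc i)) s
  rewrite defect-suc-suc-suc i s | ext-suc (suc i) (suc s) | ext-suc (suc i) s | ext-suc i (2 + s) =
  lemma (ext (2 + i) s) (ext (suc i) (2 + s)) (ext i (4 + s)) (defect (3 + i) s) (defect (2 + i) (2 + s))
  where
  lemma : ∀ a b c d e → 2 * (a + b) + (c + d + e) ≡ (a + b + (b + c)) + a + d + e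
  lemma = solve-∀

-- Raising `s` replaces the leading merge term `ext j s` by `ext j (1 + s)` and adds the same value
-- to the sum, whence the factor 2.
ext₁∞-suc : ∀ j s → ext₁∞ (suc j) (suc s) + ext j s ≡
            ext₁∞ (suc j) s + ext₁∞ j (2 + s) + 2 * ext j (1 + s)
ext₁∞-suc j s = lemma (ext j s) (ext j (suc s)) (Σ< s (ext j ∘ suc))
  (ext₁∞ j (suc s)) (ext₁∞ j (2 + s)) (Σ< s (ext₁∞ j ∘ suc))
  where
  lemma : ∀ a b c d e f →
    ((b + (c + b)) + (e + (f + d))) + a ≡ ((a + c) + (d + f)) + e + 2 * b
  lemma = solve-∀

ext₁∞-closed : ∀ j s → ext₁∞ j s + defect j s ≡ j * ext j s
ext₁∞-closed zero    s       = refl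
ext₁∞-closed (suc j) zero    = begin
  ((ext j 0 + 0) + (ext₁∞ j 1 + 0)) + defect (suc j) 0
    ≡⟨ lemma (ext j 0) (ext₁∞ j 1) (defect (suc j) 0) ⟩
  ext₁∞ j 1 + (ext j 0 + defect (suc j) 0)
    ≡⟨ cong (ext₁∞ j 1 +_) (defect-zero j) ⟩
  ext₁∞ j 1 + (ext j 1 + defect j 1)
    ≡⟨ lemma′ (ext₁∞ j 1) (ext j 1) (defect j 1) ⟩
  ext j 1 + (ext₁∞ j 1 + defect j 1)
    ≡⟨ cong (ext j 1 +_) (ext₁∞-closed j 1) ⟩
  suc j * ext j 1
    ≡⟨ cong (suc j *_) (+-identityʳ (ext j 1)) ⟨
  suc j * (ext j 1 + 0) ∎
  where
  lemma : ∀ a b c → ((a + 0) + (b + 0)) + c ≡ b + (a + c)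
  lemma = solve-∀
  lemma′ : ∀ a b c → a + (b + c) ≡ b + (a + c)
  lemma′ = solve-∀
-- In place of subtraction, `n₀` is added for `ext₁∞-suc`, and `e₀` and `e₂` for the two induction
-- hypotheses.
ext₁∞-closed (suc j) (suc s) = +-cancelʳ-≡ (n₀ + e₀ + e₂) _ _ (begin
  (x + e) + (n₀ + e₀ + e₂)
    ≡⟨ lemma₁ x e n₀ e₀ e₂ ⟩
  (x + n₀) + (e + e₀ + e₂)
    ≡⟨ cong (_+ (e + e₀ + e₂)) (ext₁∞-suc j s) ⟩
  (ext₁∞ (suc j) s + ext₁∞ j (2 + s) + 2 * n₁) + (e + e₀ + e₂)
    ≡⟨ lemma₂ (ext₁∞ (suc j) s) (ext₁∞ j (2 + s)) n₁ e e₀ e₂ ⟩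
  (ext₁∞ (suc j) s + e₀) + (ext₁∞ j (2 + s) + e₂) + (2 * n₁ + e)
    ≡⟨ cong₂ _+_ (cong₂ _+_ (ext₁∞-closed (suc j) s) (ext₁∞-closed j (2 + s))) (defect-suc j s) ⟩
  suc j * ext (suc j) s + j * n₂ + (n₂ + n₀ + e₀ + e₂)
    ≡⟨ lemma₃ j (ext (suc j) s) n₀ n₂ e₀ e₂ ⟩
  suc j * (ext (suc j) s + n₂) + (n₀ + e₀ + e₂)
    ≡⟨ cong (λ y → suc j * y + (n₀ + e₀ + e₂)) (ext-suc j s) ⟨
  suc j * ext (suc j) (suc s) + (n₀ + e₀ + e₂) ∎)
  where
  x = ext₁∞ (suc j) (suc s)
  e = defect (suc j) (suc s)
  n₀ = ext j s
  n₁ = ext j (1 + s)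
  n₂ = ext j (2 + s)
  e₀ = defect (suc j) s
  e₂ = defect j (2 + s)
  lemma₁ : ∀ x e n e₀ e₂ → (x + e) + (n + e₀ + e₂) ≡ (x + n) + (e + e₀ + e₂)
  lemma₁ = solve-∀
  lemma₂ : ∀ a b n e e₀ e₂ → (a + b + 2 * n) + (e + e₀ + e₂) ≡ (a + e₀) + (b + e₂) + (2 * n + e)
  lemma₂ = solve-∀
  lemma₃ : ∀ j n n₀ n₂ e₀ e₂ → suc j * n + j * n₂ + (n₂ + n₀ + e₀ + e₂) ≡ suc j * (n + n₂) + (n₀ + e₀ + e₂)
  lemma₃ = solve-∀

-- The count with exactly one repeated letter

defect-one : ∀ m → defect (suc m) 1 ≡ paths⁻ m (3 + m)
defect-one zero    = refl
defect-one (suc i) = begin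
  paths i (2 + (i + 1)) + 1 * paths⁻ i (3 + (i + 1))
    ≡⟨ cong (λ x → paths i (2 + x) + 1 * paths⁻ i (3 + x)) (+-comm i 1) ⟩
  paths i (3 + i) + 1 * paths⁻ i (4 + i)
    ≡⟨ lemma (paths i (3 + i)) (paths⁻ i (4 + i)) ⟩
  paths⁻ i (4 + i) + paths i (3 + i)
    ≡⟨ paths-suc i (3 + i) ⟨
  paths i (4 + i) ∎
  where
  lemma : ∀ a b → a + 1 * b ≡ b + a
  lemma = solve-∀

-- The root is the one-letter word, with `k = s = 1`; of the `suc m` letters put in front, `m` are
-- new. This gives length `2 + m` over `1 + m` letters.
pairCount : ℕ → ℕ
pairCount m = ext₁ (suc m) 1 1

pairCount-paths : ∀ m → pairCount m + paths m (2 + m) + suc m * paths m (3 + m) ≡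
                  suc m * paths (suc m) (2 + m)
pairCount-paths m = begin
  pairCount m + paths m (2 + m) + suc m * paths m (3 + m)
    ≡⟨ cong (λ x → pairCount m + x + suc m * paths m (3 + m)) closed₀ ⟨
  pairCount m + (ext m 2 + paths⁻ m (3 + m)) + suc m * paths m (3 + m)
    ≡⟨ cong (_+ suc m * paths m (3 + m)) (+-assoc (pairCount m) (ext m 2) _) ⟨
  pairCount m + ext m 2 + paths⁻ m (3 + m) + suc m * paths m (3 + m)
    -- The shortfall of `ext m 2` in its closed form is exactly `defect (suc m) 1`, so both
    -- corrections are absorbed together.
    ≡⟨ cong₂ (λ x y → x + y + suc m * paths m (3 + m)) (ext₁-≡ m 1) (sym (defect-one m)) ⟩
  ext₁∞ (suc m) 1 + defect (suc m) 1 + suc m * paths m (3 + m)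
    ≡⟨ cong (_+ suc m * paths m (3 + m)) (ext₁∞-closed (suc m) 1) ⟩
  suc m * ext (suc m) 1 + suc m * paths m (3 + m)
    ≡⟨ *-distribˡ-+ (suc m) (ext (suc m) 1) _ ⟨
  suc m * (ext (suc m) 1 + paths m (3 + m))
    ≡⟨ cong (suc m *_) closed₁ ⟩
  suc m * paths (suc m) (2 + m) ∎
  where
  closed₀ : ext m 2 + paths⁻ m (3 + m) ≡ paths m (2 + m)
  closed₀ = subst (λ x → ext m 2 + paths⁻ m (3 + x) ≡ paths m (2 + x))
    (+-identityʳ m) (ext-closed+ m 2 0)
  closed₁ : ext (suc m) 1 + paths m (3 + m) ≡ paths (suc m) (2 + m)
  closed₁ = subst (λ x → ext (suc m) 1 + paths m (3 + x) ≡ paths (suc m) (2 + x))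
    (+-identityʳ m) (ext-closed+ (suc m) 1 0)

pairCount-closed : ∀ m → (3 + m) * pairCount m ≡ 3 * (suc m * paths m (2 + m))
-- The factor `3 + m` lets the absorption identities turn every binomial coefficient into a multiple
-- of `q`; the added terms are those that a subtraction would remove.
pairCount-closed m = +-cancelʳ-≡ ((3 + m) * q + suc m * (suc (m + (2 + m)) * q)) _ _ (begin
  (3 + m) * pairCount m + ((3 + m) * q + suc m * (suc (m + (2 + m)) * q))
    ≡⟨ cong (λ x → (3 + m) * pairCount m + ((3 + m) * q + suc m * x)) ([1+b]*paths m (2 + m)) ⟨
  (3 + m) * pairCount m + ((3 + m) * q + suc m * ((3 + m) * paths m (3 + m)))
    ≡⟨ lemma m (pairCount m) q (paths m (3 + m)) ⟩
  (3 + m) * (pairCount m + q + suc m * paths m (3 + m))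
    ≡⟨ cong ((3 + m) *_) (trans (pairCount-paths m) ([1+a]*paths m (2 + m))) ⟩
  (3 + m) * (suc (m + (2 + m)) * q)
    ≡⟨ lemma′ m q ⟩
  3 * (suc m * q) + ((3 + m) * q + suc m * (suc (m + (2 + m)) * q)) ∎)
  where
  q = paths m (2 + m)
  lemma : ∀ m x q p → (3 + m) * x + ((3 + m) * q + suc m * ((3 + m) * p)) ≡ (3 + m) * (x + q + suc m * p)
  lemma = solve-∀
  lemma′ : ∀ m q → (3 + m) * (suc (m + (2 + m)) * q) ≡
                   3 * (suc m * q) + ((3 + m) * q + suc m * (suc (m + (2 + m)) * q))
  lemma′ = solve-∀

-- The quotient of consecutive closed forms: one absorption in each argument takes
-- `paths (suc m) (3 + m)` to `paths m (2 + m)`.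
pairCount-suc : ∀ m → pairCount (suc m) * ((1 + m) ^ 2 * (4 + m)) ≡ (6 + 4 * m) * (2 + m) ^ 2 * pairCount m
pairCount-suc m = *-cancelˡ-≡ _ _ (3 + m) (begin
  (3 + m) * (pairCount (suc m) * ((1 + m) ^ 2 * (4 + m)))
    ≡⟨ lemma₁ m (pairCount (suc m)) ⟩
  (3 + m) * (1 + m) * (1 + m) * ((4 + m) * pairCount (suc m))
    ≡⟨ cong ((3 + m) * (1 + m) * (1 + m) *_) (pairCount-closed (suc m)) ⟩
  (3 + m) * (1 + m) * (1 + m) * (3 * ((2 + m) * paths (suc m) (3 + m)))
    ≡⟨ lemma₂ m (paths (suc m) (3 + m)) ⟩
  3 * (1 + m) * (2 + m) * (3 + m) * ((1 + m) * paths (suc m) (3 + m))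
    ≡⟨ cong (3 * (1 + m) * (2 + m) * (3 + m) *_) ([1+a]*paths m (3 + m)) ⟩
  3 * (1 + m) * (2 + m) * (3 + m) * (suc (m + (3 + m)) * paths m (3 + m))
    ≡⟨ lemma₃ m (paths m (3 + m)) ⟩
  3 * (1 + m) * (2 + m) * suc (m + (3 + m)) * ((3 + m) * paths m (3 + m))
    ≡⟨ cong (3 * (1 + m) * (2 + m) * suc (m + (3 + m)) *_) ([1+b]*paths m (2 + m)) ⟩
  3 * (1 + m) * (2 + m) * suc (m + (3 + m)) * (suc (m + (2 + m)) * paths m (2 + m))
    -- Here `2m + 4` yields the second factor `2 + m`, and its remaining 2 turns `2m + 3` into
    -- `6 + 4 * m`.
    ≡⟨ lemma₄ m (paths m (2 + m)) ⟩
  (6 + 4 * m) * (2 + m) ^ 2 * (3 * (suc m * paths m (2 + m)))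
    ≡⟨ cong ((6 + 4 * m) * (2 + m) ^ 2 *_) (pairCount-closed m) ⟨
  (6 + 4 * m) * (2 + m) ^ 2 * ((3 + m) * pairCount m)
    ≡⟨ lemma₅ ((6 + 4 * m) * (2 + m) ^ 2) (3 + m) (pairCount m) ⟩
  (3 + m) * ((6 + 4 * m) * (2 + m) ^ 2 * pairCount m) ∎)
  where
  lemma₁ : ∀ m x → (3 + m) * (x * ((1 + m) * ((1 + m) * 1) * (4 + m))) ≡
                   (3 + m) * (1 + m) * (1 + m) * ((4 + m) * x)
  lemma₁ = solve-∀
  lemma₂ : ∀ m p → (3 + m) * (1 + m) * (1 + m) * (3 * ((2 + m) * p)) ≡
                   3 * (1 + m) * (2 + m) * (3 + m) * ((1 + m) * p)
  lemma₂ = solve-∀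
  lemma₃ : ∀ m p → 3 * (1 + m) * (2 + m) * (3 + m) * (suc (m + (3 + m)) * p) ≡
                   3 * (1 + m) * (2 + m) * suc (m + (3 + m)) * ((3 + m) * p)
  lemma₃ = solve-∀
  lemma₄ : ∀ m q → 3 * (1 + m) * (2 + m) * suc (m + (3 + m)) * (suc (m + (2 + m)) * q) ≡
                   (6 + 4 * m) * ((2 + m) * ((2 + m) * 1)) * (3 * (suc m * q))
  lemma₄ = solve-∀
  lemma₅ : ∀ a b c → a * (b * c) ≡ b * (a * c)
  lemma₅ = solve-∀

-- Summation over the enumerated words

sumOver : List A → (A → ℕ) → ℕ
sumOver xs f = sum (List.map f xs)

sumOver-++ : (xs ys : List A) (f : A → ℕ) → sumOver (xs ++ ys) f ≡ sumOver xs f + sumOver ys f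
sumOver-++ xs ys f = trans (cong sum (map-++ f xs ys)) (sum-++ (List.map f xs) _)

sumOver-map : (g : A → B) (xs : List A) (f : B → ℕ) → sumOver (List.map g xs) f ≡ sumOver xs (f ∘ g)
sumOver-map g xs f = cong sum (sym (map-∘ xs))

sumOver-concatMap : (g : A → List B) (xs : List A) (f : B → ℕ) →
                    sumOver (concatMap g xs) f ≡ sumOver xs (λ x → sumOver (g x) f)
sumOver-concatMap g []       f = refl
sumOver-concatMap g (x ∷ xs) f =
  trans (sumOver-++ (g x) _ f) (cong (_ +_) (sumOver-concatMap g xs f))

sumOver-cong : (xs : List A) {f g : A → ℕ} → (∀ x → x ∈ xs → f x ≡ g x) → sumOver xs f ≡ sumOver xs g
sumOver-cong xs eq = cong sum (map-cong-local (All.tabulate (eq _)))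

sumOver-+ : (xs : List A) (f g : A → ℕ) → sumOver xs (λ x → f x + g x) ≡ sumOver xs f + sumOver xs g
sumOver-+ []       f g = refl
sumOver-+ (x ∷ xs) f g rewrite sumOver-+ xs f g = lemma (f x) (g x) (sumOver xs f) (sumOver xs g)
  where
  lemma : ∀ a b c d → a + b + (c + d) ≡ a + c + (b + d)
  lemma = solve-∀

sumOver-0 : (xs : List A) → sumOver xs (λ _ → 0) ≡ 0
sumOver-0 []       = refl
sumOver-0 (x ∷ xs) = sumOver-0 xs

sumOver-1 : (xs : List A) → sumOver xs (λ _ → 1) ≡ length xs
sumOver-1 []       = refl
sumOver-1 (x ∷ xs) = cong suc (sumOver-1 xs)

sumOver-below : ∀ k m f → sumOver (below k m) (f ∘ toℕ) ≡ Σ< (m ⊓ k) f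
sumOver-below zero    m       f = cong (λ l → Σ< l f) (sym (⊓-zeroʳ m))
sumOver-below (suc k) zero    f = refl
sumOver-below (suc k) (suc m) f = begin
  f 0 + sumOver (List.map suc (below k m)) (f ∘ toℕ)
    ≡⟨ cong (f 0 +_) (sumOver-map suc (below k m) _) ⟩
  f 0 + sumOver (below k m) (f ∘ suc ∘ toℕ)
    ≡⟨ cong (f 0 +_) (sumOver-below k m (f ∘ suc)) ⟩
  f 0 + Σ< (m ⊓ k) (f ∘ suc)
    ≡⟨ Σ<-front (m ⊓ k) f ⟨
  Σ< (suc (m ⊓ k)) f ∎

sumOver-inserts : (w : Word k n) → Surjective w → ∀ f →
                  sumOver (inserts w) (f ∘ leastTop) ≡ overInserts f (leastTop w)
sumOver-inserts {k} w surj f = begin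
  sumOver (inserts w) (f ∘ leastTop)
    ≡⟨ sumOver-map (λ i → insert i w) (below (suc k) (suc s)) _ ⟩
  f (leastTop (insert zero w)) + sumOver (List.map suc (below k s)) (λ i → f (leastTop (insert i w)))
    ≡⟨ cong₂ _+_ (cong f (leastTop-insert-zero w)) (sumOver-map suc (below k s) _) ⟩
  f (suc s) + sumOver (below k s) (λ i → f (leastTop (insert (suc i) w)))
    ≡⟨ cong (f (suc s) +_) (sumOver-cong (below k s) λ i i∈ →
         cong f (leastTop-insert-suc i w surj (∈-below⁻ i i∈))) ⟩
  f (suc s) + sumOver (below k s) (f ∘ suc ∘ toℕ)
    ≡⟨ cong (f (suc s) +_) (sumOver-below k s (f ∘ suc)) ⟩
  f (suc s) + Σ< (s ⊓ k) (f ∘ suc)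
    ≡⟨ cong (λ l → f (suc s) + Σ< l (f ∘ suc)) (m≤n⇒m⊓n≡m (leastTop≤k w)) ⟩
  overInserts f s ∎
  where s = leastTop w

leastTop-merge : ∀ i (w : Word k n) → Surjective w → toℕ i ≤ leastTop w →
                 leastTop (i ∷ w) ≡ mergeTop (leastTop w) (toℕ i)
leastTop-merge zero    w surj i≤ = leastTop-zero∷ w
leastTop-merge (suc i) w surj i≤ = leastTop-suc∷ i w (surj zero) i≤

sumOver-merges : (w : Word k n) → Surjective w → ∀ f →
                 sumOver (merges w) (f ∘ leastTop) ≡ overMerges k f (leastTop w)
sumOver-merges {k} w surj f = begin
  sumOver (merges w) (f ∘ leastTop)
    ≡⟨ sumOver-map (_∷ w) (below k (suc s)) _ ⟩
  sumOver (below k (suc s)) (λ i → f (leastTop (i ∷ w)))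
    ≡⟨ sumOver-cong (below k (suc s)) (λ i i∈ → cong f (leastTop-merge i w surj (s≤s⁻¹ (∈-below⁻ i i∈)))) ⟩
  sumOver (below k (suc s)) (f ∘ mergeTop s ∘ toℕ)
    ≡⟨ sumOver-below k (suc s) (f ∘ mergeTop s) ⟩
  overMerges k f s ∎
  where s = leastTop w

sumWords : ∀ k n → (ℕ → ℕ) → ℕ
sumWords k n f = sumOver (words k n) (f ∘ leastTop)

-- The weight `f` is pulled back along the deletion of the first letter.
sumWords-suc : ∀ k n f → sumWords (suc k) (suc n) f ≡
               sumWords k n (overInserts f) + sumWords (suc k) n (overMerges (suc k) f)
sumWords-suc k n f = begin
  sumWords (suc k) (suc n) f
    ≡⟨ sumOver-++ (concatMap inserts (words k n)) _ _ ⟩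
  sumOver (concatMap inserts (words k n)) (f ∘ leastTop) +
  sumOver (concatMap merges (words (suc k) n)) (f ∘ leastTop)
    ≡⟨ cong₂ _+_ (sumOver-concatMap inserts (words k n) _) (sumOver-concatMap merges (words (suc k) n) _) ⟩
  sumOver (words k n) (λ w → sumOver (inserts w) (f ∘ leastTop)) +
  sumOver (words (suc k) n) (λ w → sumOver (merges w) (f ∘ leastTop))
    ≡⟨ cong₂ _+_
         (sumOver-cong (words k n) λ w w∈ → sumOver-inserts w (proj₁ (words-sound k n w∈)) f)
         (sumOver-cong (words (suc k) n) λ w w∈ → sumOver-merges w (proj₁ (words-sound (suc k) n w∈)) f) ⟩
  sumWords k n (overInserts f) + sumWords (suc k) n (overMerges (suc k) f) ∎

words-empty : ∀ k n → n < k → words k n ≡ []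
words-empty (suc k) zero    _         = refl
words-empty (suc k) (suc n) (s≤s n<k)
  rewrite words-empty k n n<k | words-empty (suc k) n (m<n⇒m<1+n n<k) = refl

-- A merge would need a tail too short to be surjective.
sumWords-permutations : ∀ n f → sumWords (suc n) (suc n) f ≡ sumWords n n (overInserts f)
sumWords-permutations n f = begin
  sumWords (suc n) (suc n) f
    ≡⟨ sumWords-suc n n f ⟩
  sumWords n n (overInserts f) + sumWords (suc n) n (overMerges (suc n) f)
    ≡⟨ cong (λ ws → sumWords n n (overInserts f) + sumOver ws (overMerges (suc n) f ∘ leastTop))
         (words-empty (suc n) n ≤-refl) ⟩
  sumWords n n (overInserts f) + 0
    ≡⟨ +-identityʳ _ ⟩
  sumWords n n (overInserts f) ∎

-- The left side counts the words of length n + j + 1 over n + j letters: those that descend from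
-- words of length n + 1 with the repetition already made, and those where it is still to be made.
sumWords-ext₁ : ∀ n j → sumWords n (suc n) (ext j) + sumWords (suc n) (suc n) (ext₁ j (suc n)) ≡
                ext₁ (n + j) 1 1
-- There is no letter for the first sum; the second has a single word, whose `leastTop` is 1.
sumWords-ext₁ zero    j = +-identityʳ _
sumWords-ext₁ (suc n) j = begin
  sumWords (suc n) (2 + n) (ext j) + sumWords (2 + n) (2 + n) (ext₁ j (2 + n))
    ≡⟨ cong₂ _+_ (sumWords-suc n (suc n) (ext j)) (sumWords-permutations (suc n) (ext₁ j (2 + n))) ⟩
  sumWords n (suc n) (ext (suc j)) + sumWords (suc n) (suc n) (overMerges (suc n) (ext j))
    + sumWords (suc n) (suc n) (overInserts (ext₁ j (2 + n)))
    ≡⟨ +-assoc (sumWords n (suc n) (ext (suc j))) _ _ ⟩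
  sumWords n (suc n) (ext (suc j)) + (sumWords (suc n) (suc n) (overMerges (suc n) (ext j))
    + sumWords (suc n) (suc n) (overInserts (ext₁ j (2 + n))))
    ≡⟨ cong (sumWords n (suc n) (ext (suc j)) +_) (sumOver-+ (words (suc n) (suc n)) _ _) ⟨
  sumWords n (suc n) (ext (suc j)) + sumWords (suc n) (suc n) (ext₁ (suc j) (suc n))
    ≡⟨ sumWords-ext₁ n (suc j) ⟩
  ext₁ (n + suc j) 1 1
    ≡⟨ cong (λ x → ext₁ x 1 1) (+-suc n j) ⟩
  ext₁ (suc n + j) 1 1 ∎

op≡pairCount : ∀ m → op (2 + m) (1 + m) ρ₁₂₃ ≡ pairCount m
op≡pairCount m = begin
  op (2 + m) (1 + m) ρ₁₂₃
    ≡⟨ op≡length-words (2 + m) (1 + m) ⟩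
  length (words (1 + m) (2 + m))
    ≡⟨ sumOver-1 (words (1 + m) (2 + m)) ⟨
  sumWords (1 + m) (2 + m) (ext 0)
    ≡⟨ +-identityʳ _ ⟨
  sumWords (1 + m) (2 + m) (ext 0) + 0
    -- `ext₁ 0` vanishes: with no letter left, a repetition can no longer be made.
    ≡⟨ cong (sumWords (1 + m) (2 + m) (ext 0) +_) (sumOver-0 (words (2 + m) (2 + m))) ⟨
  sumWords (1 + m) (2 + m) (ext 0) + sumWords (2 + m) (2 + m) (ext₁ 0 (2 + m))
    ≡⟨ sumWords-ext₁ (suc m) 0 ⟩
  ext₁ (suc m + 0) 1 1
    ≡⟨ cong (λ x → ext₁ x 1 1) (+-identityʳ (suc m)) ⟩
  pairCount m ∎

-- Opened only here, as +_ is ambiguous with the operator sections above.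
open import Data.Integer.Base using (+_)

-- In unnormalised rationals the claim is a cross multiplication, free of the gcds of normalised
-- fractions.
/-*-≡ : ∀ x y a d .{{_ : NonZero d}} → x * d ≡ a * y → + x / 1 ≡ (+ a / d) ℚ.* (+ y / 1)
/-*-≡ x y a (suc d) eq = ℚ.toℚᵘ-injective
  (ℚᵘ.≃-trans (ℚ.toℚᵘ-fromℚᵘ (mkℚᵘ (+ x) 0))
  (ℚᵘ.≃-trans (*≡* cross)
  (ℚᵘ.≃-trans (ℚᵘ.≃-sym (ℚᵘ.*-cong (ℚ.toℚᵘ-fromℚᵘ (mkℚᵘ (+ a) d)) (ℚ.toℚᵘ-fromℚᵘ (mkℚᵘ (+ y) 0))))
              (ℚᵘ.≃-sym (ℚ.toℚᵘ-homo-* (+ a / suc d) (+ y / 1))))))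
  where
  cross : + x ℤ.* + (suc d * 1) ≡ (+ a ℤ.* + y) ℤ.* + 1
  cross = begin
    + x ℤ.* + (suc d * 1)  ≡⟨ ℤ.pos-* x (suc d * 1) ⟨
    + (x * (suc d * 1))    ≡⟨ cong (λ z → + (x * z)) (*-identityʳ (suc d)) ⟩
    + (x * suc d)          ≡⟨ cong +_ eq ⟩
    + (a * y)              ≡⟨ ℤ.pos-* a y ⟩
    + a ℤ.* + y            ≡⟨ ℤ.*-identityʳ (+ a ℤ.* + y) ⟨
    (+ a ℤ.* + y) ℤ.* + 1  ∎

theorem5 : op 2 1 ρ₁₂₃ ≡ 1
    × (∀ (n : ℕ) (n>2 : n > 2) →
    + op n (n ∸ 1) ρ₁₂₃ / 1
    ≡ ((+ ((4 * n ∸ 6) * (n ∸ 1) ^ 2)) / ((n ∸ 2) ^ 2 * (n + 1))) {{denominator-nonZero n>2}}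
    ℚ.* (+ op (n ∸ 1) (n ∸ 2) ρ₁₂₃ / 1))
theorem5 = op≡pairCount 0 , recurrence
  where
  recurrence : ∀ n (n>2 : n > 2) →
    + op n (n ∸ 1) ρ₁₂₃ / 1
    ≡ ((+ ((4 * n ∸ 6) * (n ∸ 1) ^ 2)) / ((n ∸ 2) ^ 2 * (n + 1))) {{denominator-nonZero n>2}}
    ℚ.* (+ op (n ∸ 1) (n ∸ 2) ρ₁₂₃ / 1)
  recurrence (suc (suc (suc m))) n>2@(s≤s (s≤s (s≤s _))) =
    /-*-≡ (op (3 + m) (2 + m) ρ₁₂₃) (op (2 + m) (1 + m) ρ₁₂₃)
      ((4 * (3 + m) ∸ 6) * (2 + m) ^ 2) ((1 + m) ^ 2 * (3 + m + 1)) {{denominator-nonZero n>2}} (begin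
      op (3 + m) (2 + m) ρ₁₂₃ * ((1 + m) ^ 2 * (3 + m + 1))
        ≡⟨ cong₂ (λ x d → x * ((1 + m) ^ 2 * d)) (op≡pairCount (suc m)) (+-comm (3 + m) 1) ⟩
      pairCount (suc m) * ((1 + m) ^ 2 * (4 + m))
        ≡⟨ pairCount-suc m ⟩
      (6 + 4 * m) * (2 + m) ^ 2 * pairCount m
        ≡⟨ cong₂ (λ c x → c * (2 + m) ^ 2 * x) coefficient (sym (op≡pairCount m)) ⟩
      (4 * (3 + m) ∸ 6) * (2 + m) ^ 2 * op (2 + m) (1 + m) ρ₁₂₃ ∎)
    where
    coefficient : 6 + 4 * m ≡ 4 * (3 + m) ∸ 6
    -- `4 * 3 + 4 * m ∸ 6` computes to `6 + 4 * m`.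
    coefficient = cong (_∸ 6) (sym (*-distribˡ-+ 4 3 m))
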